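{- Every $k$-colorable graph of pathwidth at most $p$ is $p(k-1)$-almost equitably $k$-colorable.
   Context: A $k$-coloring is equitable if its $k$ color classes (stable sets) have sizes pairwise differing by at most one. A graph $G$ is $q$-almost equitably $k$-colorable if there is a set $X$ of at most $q$ vertices such that $G\setminus X$ has an equitable $k$-coloring. -}

module Defs where

open import Data.Fin.Base using (Fin) renaming (_≤_ to _≤ᶠ_)
open import Data.Fin.Subset using (Subset; _∈_; _∉_; _⊆_; _─_; ∣_∣)
open import Data.Fin.Subset.Properties using (_∈?_; x∈p∧x∉q⇒x∈p─q)
open import Data.Nat.Base using (ℕ; _⊔_; _∸_; _≤_; ∣_-_∣)
open import Data.Product.Base using (Σ-syntax; ∃-syntax; _×_; _,_)
open import Data.Vec.Functional using (foldr)
open import Level using (0ℓ)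
open import Relation.Binary.Core using (Rel)
open import Relation.Binary.Definitions using (Decidable; Symmetric)
open import Relation.Binary.PropositionalEquality.Core using (_≡_)
open import Relation.Nullary.Decidable.Core using (¬?; _×-dec_)
open import Relation.Nullary.Negation.Core using (¬_)

-- Finite simple graphs. The vertices form a subset of an ambient set Fin n,
-- so that deleting vertices yields a graph over the same ambient set.
record Graph (n : ℕ) : Set₁ where
  field
    V      : Subset n
    E      : Rel (Fin n) 0ℓ
    E?     : Decidable E
    E-sym  : Symmetric E
    E-irr  : ∀ {v} → ¬ E v v
    E⇒V    : ∀ {u v} → E u v → u ∈ V

open Graph public

infixl 5 _∖_

_∖_ : ∀ {n} → Graph n → Subset n → Graph n
G ∖ X = record
  { V     = V G ─ X
  ; E     = λ u v → E G u v × u ∉ X × v ∉ X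
  ; E?    = λ u v → E? G u v ×-dec (¬? (u ∈? X) ×-dec ¬? (v ∈? X))
  ; E-sym = λ { (e , u∉X , v∉X) → E-sym G e , v∉X , u∉X }
  ; E-irr = λ { (e , _) → E-irr G e }
  ; E⇒V   = λ { (e , u∉X , _) → x∈p∧x∉q⇒x∈p─q (E⇒V G e) u∉X }
  }

Stable : ∀ {n} → Graph n → Subset n → Set
Stable G S = ∀ {u v} → u ∈ S → v ∈ S → ¬ E G u v

-- A k-coloring is given by its color classes: k pairwise disjoint, possibly
-- empty, stable sets whose union is the vertex set.
record Coloring {n : ℕ} (k : ℕ) (G : Graph n) : Set where
  field
    class    : Fin k → Subset n
    class⊆V  : ∀ c → class c ⊆ V G
    covers   : ∀ {v} → v ∈ V G → ∃[ c ] v ∈ class c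
    disjoint : ∀ {v c d} → v ∈ class c → v ∈ class d → c ≡ d
    stable   : ∀ c → Stable G (class c)

open Coloring public

Colorable : ∀ {n} → ℕ → Graph n → Set
Colorable k G = Coloring k G

Equitable : ∀ {n k} {G : Graph n} → Coloring k G → Set
Equitable C = ∀ c d → ∣ ∣ class C c ∣ - ∣ class C d ∣ ∣ ≤ 1

EquitablyColorable : ∀ {n} → ℕ → Graph n → Set
EquitablyColorable k G = Σ[ C ∈ Coloring k G ] Equitable C

AlmostEquitablyColorable : ∀ {n} → (q k : ℕ) → Graph n → Set
AlmostEquitablyColorable q k G =
  ∃[ X ] X ⊆ V G × ∣ X ∣ ≤ q × EquitablyColorable k (G ∖ X)

record PathDecomposition {n : ℕ} (G : Graph n) : Set where
  field
    length       : ℕ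
    bag          : Fin length → Subset n
    bag⊆V        : ∀ i → bag i ⊆ V G
    vertex-cover : ∀ {v} → v ∈ V G → ∃[ i ] v ∈ bag i
    edge-cover   : ∀ {u v} → E G u v → ∃[ i ] u ∈ bag i × v ∈ bag i
    contiguous   : ∀ {v i j l} → i ≤ᶠ j → j ≤ᶠ l →
                   v ∈ bag i → v ∈ bag l → v ∈ bag j

  -- Maximum bag size minus one. The truncated subtraction only matters when
  -- all bags are empty: the width is then 0 rather than -1, which does not
  -- affect upper bounds by natural numbers.
  width : ℕ
  width = foldr (λ B m → ∣ B ∣ ⊔ m) 0 bag ∸ 1

open PathDecomposition public

-- The pathwidth is the minimum width of a path decomposition, so it is at
-- most p exactly when some path decomposition has width at most p.
PathwidthAtMost : ∀ {n} → ℕ → Graph n → Set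
PathwidthAtMost p G = Σ[ D ∈ PathDecomposition G ] width D ≤ p

{-# OPTIONS --safe #-}
-- Order the vertices by the first bag containing them. Every prefix of this
-- order has at most p vertices with a neighbour outside the prefix. Given a
-- size t and color classes i and j with ∣ j ∣ ≤ t ≤ ∣ i ∣, exchange the colors
-- i and j on a growing prefix and delete its boundary: class i loses at most
-- one vertex per step and ends up inside the old class j, so at some point its
-- size is exactly t. Hence each color but the last one can be brought to its
-- target size at the cost of p vertices; averaging provides i and j, or else a
-- class that has at most t + p vertices and can simply be shrunk.
module Submission where

open import Data.Fin.Base using (Fin; zero; suc; toℕ; punchIn; punchOut; combine)
open import Data.Fin.Permutation.Components using (transpose; transpose-inverse)
open import Data.Fin.Properties as Fin
  using (any?; _≟_; toℕ<n; toℕ-injective; punchIn-punchOut; punchInᵢ≢i; punchIn-injective;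
         combine-monoˡ-<; combine-injectiveʳ)
open import Data.Fin.Subset using (Subset; inside; outside; _∈_; _∉_; _⊆_; _∩_; _∪_; _─_; ⁅_⁆; ⊥; ∣_∣)
open import Data.Fin.Subset.Properties
open import Data.Nat.Base
  using (ℕ; zero; suc; _+_; _*_; _∸_; _⊔_; _≤_; _<_; z≤n; s≤s) renaming (∣_-_∣ to dist)
open import Data.Nat.DivMod using (_/_; _%_; m≡m%n+[m/n]*n; m%n<n)
open import Data.Nat.Properties as ℕ hiding (_≟_)
open import Data.Nat.Tactic.RingSolver using (solve-∀)
open import Data.Product.Base using (Σ-syntax; ∃-syntax; _×_; _,_; proj₁; proj₂)
open import Data.Sum.Base using (inj₁; inj₂)
open import Data.Vec.Base using ([]; _∷_; tabulate)
open import Data.Vec.Functional using (foldr)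
open import Data.Vec.Properties using (lookup∘tabulate; lookup⇒[]=; []=⇒lookup)
open import Defs
open import Function.Base using (_∘_)
open import Level using (0ℓ)
open import Relation.Binary.Definitions using (tri<; tri≈; tri>)
open import Relation.Binary.PropositionalEquality
open import Relation.Nullary.Decidable using (yes; no; does; _×-dec_; dec-true)
open import Relation.Nullary.Negation using (contradiction)
open import Relation.Unary using (Pred; Decidable)

private
  variable
    n k : ℕ

-- Subsets

module _ {P : Pred (Fin n) 0ℓ} (P? : Decidable P) where

  filter : Subset n
  filter = tabulate (does ∘ P?)

  ∈-filter⁺ : ∀ {v} → P v → v ∈ filter
  ∈-filter⁺ {v} Pv =
    lookup⇒[]= v filter (trans (lookup∘tabulate (does ∘ P?) v) (dec-true (P? v) Pv))

  ∈-filter⁻ : ∀ {v} → v ∈ filter → P v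
  ∈-filter⁻ {v} v∈ with P? v | trans (sym (lookup∘tabulate (does ∘ P?) v)) ([]=⇒lookup v∈)
  ... | yes Pv | _ = Pv
  ... | no _   | ()

x∈p─q⇒x∉q : ∀ (p q : Subset n) {x} → x ∈ p ─ q → x ∉ q
x∈p─q⇒x∉q p q {x} x∈p─q x∈q with p | q | x
... | _ ∷ p′ | outside ∷ q′ | zero   = contradiction x∈q λ ()
... | _ ∷ p′ | inside  ∷ q′ | zero   = contradiction x∈p─q λ ()
... | _ ∷ p′ | _ ∷ q′       | suc y  =
  x∈p─q⇒x∉q p′ q′ (drop-there x∈p─q) (drop-there x∈q)

∣p∣≡∣p∩q∣+∣p─q∣ : ∀ (p q : Subset n) → ∣ p ∣ ≡ ∣ p ∩ q ∣ + ∣ p ─ q ∣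
∣p∣≡∣p∩q∣+∣p─q∣ []            []            = refl
∣p∣≡∣p∩q∣+∣p─q∣ (outside ∷ p) (outside ∷ q) = ∣p∣≡∣p∩q∣+∣p─q∣ p q
∣p∣≡∣p∩q∣+∣p─q∣ (outside ∷ p) (inside ∷ q)  = ∣p∣≡∣p∩q∣+∣p─q∣ p q
∣p∣≡∣p∩q∣+∣p─q∣ (inside ∷ p)  (inside ∷ q)  = cong suc (∣p∣≡∣p∩q∣+∣p─q∣ p q)
∣p∣≡∣p∩q∣+∣p─q∣ (inside ∷ p)  (outside ∷ q) =
  trans (cong suc (∣p∣≡∣p∩q∣+∣p─q∣ p q)) (sym (+-suc _ _))

∣p∣≤∣q∣+∣p─q∣ : ∀ (p q : Subset n) → ∣ p ∣ ≤ ∣ q ∣ + ∣ p ─ q ∣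
∣p∣≤∣q∣+∣p─q∣ p q =
  ≤-trans (≤-reflexive (∣p∣≡∣p∩q∣+∣p─q∣ p q)) (+-monoˡ-≤ _ (∣p∩q∣≤∣q∣ p q))

q⊆p⇒∣p∣≡∣q∣+∣p─q∣ : ∀ (p q : Subset n) → q ⊆ p → ∣ p ∣ ≡ ∣ q ∣ + ∣ p ─ q ∣
q⊆p⇒∣p∣≡∣q∣+∣p─q∣ p q q⊆p =
  trans (∣p∣≡∣p∩q∣+∣p─q∣ p q)
    (cong (λ r → ∣ r ∣ + ∣ p ─ q ∣)
      (⊆-antisym (p∩q⊆q p q) (λ x∈q → x∈p∩q⁺ (q⊆p x∈q , x∈q))))

p─q⊆r⇒∣p∣≤∣q∣+∣r∣ : ∀ (p q r : Subset n) → (∀ {x} → x ∈ p → x ∉ q → x ∈ r) → ∣ p ∣ ≤ ∣ q ∣ + ∣ r ∣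
p─q⊆r⇒∣p∣≤∣q∣+∣r∣ p q r sub = ≤-trans (∣p∣≤∣q∣+∣p─q∣ p q)
  (+-monoʳ-≤ ∣ q ∣ (p⊆q⇒∣p∣≤∣q∣ (λ x∈ → sub (p─q⊆p p q x∈) (x∈p─q⇒x∉q p q x∈))))

subset-of-size : ∀ (p : Subset n) s → s ≤ ∣ p ∣ → ∃[ q ] q ⊆ p × ∣ q ∣ ≡ s
subset-of-size {n} p zero _ = ⊥ , ⊥⊆ , ∣⊥∣≡0 n
subset-of-size (outside ∷ p) (suc s) s≤ =
  let q , q⊆p , eq = subset-of-size p (suc s) s≤ in outside ∷ q , out⊆ q⊆p , eq
subset-of-size (inside ∷ p) (suc s) (s≤s s≤) =
  let q , q⊆p , eq = subset-of-size p s s≤ in inside ∷ q , in⊆in q⊆p , cong suc eq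

-- Peels off one set at a time; each contributes at most `t - 1` vertices. Adding `k` on the left
-- avoids the subtraction and makes the bound contradict `k * t ≤ ∣ U ∣` as soon as `k` is positive.
cover-bound : ∀ {k t} (U : Subset n) (F : Fin k → Subset n) →
              (∀ {v} → v ∈ U → ∃[ c ] v ∈ F c) → (∀ c → ∣ F c ∣ < t) → ∣ U ∣ + k ≤ k * t
cover-bound {n} {k = zero} U F cov small = ≤-reflexive (trans (+-identityʳ _)
  (trans (cong ∣_∣ (Empty-unique λ { (_ , v∈U) → contradiction (proj₁ (cov v∈U)) λ () })) (∣⊥∣≡0 n)))
cover-bound {k = suc k} {t} U F cov small = begin
  ∣ U ∣ + suc k                        ≤⟨ +-monoˡ-≤ (suc k) (∣p∣≤∣q∣+∣p─q∣ U (F zero)) ⟩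
  ∣ F zero ∣ + ∣ U ─ F zero ∣ + suc k  ≡⟨ lem ∣ F zero ∣ ∣ U ─ F zero ∣ k ⟩
  suc ∣ F zero ∣ + (∣ U ─ F zero ∣ + k)
    ≤⟨ +-mono-≤ (small zero) (cover-bound (U ─ F zero) (F ∘ suc) cov′ (small ∘ suc)) ⟩
  t + k * t                            ∎
  where
  open ≤-Reasoning
  lem : ∀ a b k → a + b + suc k ≡ suc a + (b + k)
  lem = solve-∀
  cov′ : ∀ {v} → v ∈ U ─ F zero → ∃[ c ] v ∈ F (suc c)
  cov′ v∈ with cov (p─q⊆p U (F zero) v∈)
  ... | zero  , v∈F = contradiction v∈F (x∈p─q⇒x∉q U (F zero) v∈)
  ... | suc c , v∈F = c , v∈F

-- The same peeling; disjointness keeps the later sets inside what is left of `U`.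
packing-bound : ∀ {k t} (U : Subset n) (F : Fin k → Subset n) → (∀ c → F c ⊆ U) →
                (∀ {c d v} → v ∈ F c → v ∈ F d → c ≡ d) → (∀ c → t ≤ ∣ F c ∣) → k * t ≤ ∣ U ∣
packing-bound {k = zero} U F sub dis large = z≤n
packing-bound {k = suc k} {t} U F sub dis large = begin
  t + k * t                    ≤⟨ +-mono-≤ (large zero)
    (packing-bound (U ─ F zero) (F ∘ suc) sub′ (λ x y → Fin.suc-injective (dis x y)) (large ∘ suc)) ⟩
  ∣ F zero ∣ + ∣ U ─ F zero ∣  ≡⟨ q⊆p⇒∣p∣≡∣q∣+∣p─q∣ U (F zero) (sub zero) ⟨
  ∣ U ∣                        ∎
  where
  open ≤-Reasoning
  sub′ : ∀ c → F (suc c) ⊆ U ─ F zero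
  sub′ c v∈ = x∈p∧x∉q⇒x∈p─q (sub (suc c) v∈) λ v∈F₀ → contradiction (dis v∈F₀ v∈) λ ()

-- The sequence may rise arbitrarily but falls by at most one per step. Searching backwards from
-- `m`, the first index whose predecessor has a value above `t` is a descent onto `t` itself.
discrete-ivt : ∀ (a : ℕ → ℕ) {t} → (∀ s → a s ≤ suc (a (suc s))) →
               t ≤ a 0 → ∀ m → a m ≤ t → ∃[ s ] a s ≡ t
discrete-ivt a step t≤a₀ zero    am≤t = zero , ≤-antisym am≤t t≤a₀
discrete-ivt a {t} step t≤a₀ (suc m) am≤t with a m ≤? t
... | yes a≤t = discrete-ivt a step t≤a₀ m a≤t
... | no  a≰t = suc m , ≤-antisym am≤t (≤-pred (≤-trans (≰⇒> a≰t) (step m)))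

-- Colors

transpose-injective : ∀ (i j : Fin n) {c d} → transpose i j c ≡ transpose i j d → c ≡ d
transpose-injective i j eq =
  trans (sym (transpose-inverse j i)) (trans (cong (transpose j i) eq) (transpose-inverse j i))

transpose≡left : ∀ (i j : Fin n) {c} → transpose i j c ≡ i → c ≡ j
transpose≡left i j {c} eq = transpose-injective i j (trans eq (sym transpose-right))
  where
  transpose-right : transpose i j j ≡ i
  transpose-right with j ≟ i
  ... | yes refl = refl
  ... | no _ rewrite dec-true (j ≟ j) refl = refl

-- The value at i is junk.
collapse : Fin (suc (suc k)) → Fin (suc (suc k)) → Fin (suc k)
collapse i c with i ≟ c
... | yes _  = zero
... | no i≢c = punchOut i≢c

punchIn-collapse : ∀ (i : Fin (suc (suc k))) {c} → c ≢ i → punchIn i (collapse i c) ≡ c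
punchIn-collapse i {c} c≢i with i ≟ c
... | yes refl = contradiction refl c≢i
... | no i≢c   = punchIn-punchOut i≢c

-- A coloring is a total function together with the set of vertices still alive, so that deleting
-- vertices shrinks `U` and leaves `f` untouched.
module _ {K : ℕ} (U : Subset n) (f : Fin n → Fin K) where

  In : Fin K → Pred (Fin n) 0ℓ
  In c v = v ∈ U × f v ≡ c

  In? : ∀ c → Decidable (In c)
  In? c v = (v ∈? U) ×-dec (f v ≟ c)

  colorClass : Fin K → Subset n
  colorClass c = filter (In? c)

  ∈-class⁺ : ∀ {c v} → v ∈ U → f v ≡ c → v ∈ colorClass c
  ∈-class⁺ {c} v∈U eq = ∈-filter⁺ (In? c) (v∈U , eq)

  ∈-class⁻ : ∀ {c v} → v ∈ colorClass c → v ∈ U × f v ≡ c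
  ∈-class⁻ {c} = ∈-filter⁻ (In? c)

-- Proper colorings of induced subgraphs and boundaries of prefixes.

module _ (G : Graph n) where

  -- U induces a subgraph properly colored by f; f is arbitrary outside U.
  Proper : Subset n → (Fin n → Fin k) → Set
  Proper U f = ∀ {u v} → u ∈ U → v ∈ U → E G u v → f u ≢ f v

  Proper-⊆ : ∀ {U W} {f : Fin n → Fin k} → W ⊆ U → Proper U f → Proper W f
  Proper-⊆ W⊆U proper u∈ v∈ = proper (W⊆U u∈) (W⊆U v∈)

  module _ (key : Fin n → ℕ) where

    OnBoundary : ℕ → Pred (Fin n) 0ℓ
    OnBoundary s u = key u < s × ∃[ w ] E G u w × s ≤ key w

    OnBoundary? : ∀ s → Decidable (OnBoundary s)
    OnBoundary? s u = (key u <? s) ×-dec any? λ w → E? G u w ×-dec (s ≤? key w)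

    -- The maximum of these sizes over all `s` is the vertex separation number of the order. A bound
    -- on it is the only form in which pathwidth enters the balancing argument.
    boundary : ℕ → Subset n
    boundary s = filter (OnBoundary? s)

  -- Bringing one color class to a prescribed size.

  module Balancing
    (key : Fin n → ℕ) (key-injective : ∀ {u v} → key u ≡ key v → u ≡ v)
    (M : ℕ) (key<M : ∀ v → key v < M)
    (p : ℕ) (∣boundary∣≤p : ∀ s → ∣ boundary key s ∣ ≤ p)
    where

    -- The last inequality says that at most `p` vertices are deleted. The color `i` is part of the
    -- result: which color can reach size `t` depends on the coloring.
    ColorOfSize : (K t : ℕ) → Subset n → Set
    ColorOfSize K t U = Σ[ i ∈ Fin K ] Σ[ W ∈ Subset n ] Σ[ g ∈ (Fin n → Fin K) ]
      W ⊆ U × Proper W g × ∣ colorClass W g i ∣ ≡ t × ∣ U ∣ ≤ p + ∣ W ∣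

    module Exchange {K : ℕ} (U : Subset n) (f : Fin n → Fin K) (proper : Proper U f)
                    (i j : Fin K) where

      exchanged : ℕ → Fin n → Fin K
      exchanged s v with key v <? s
      ... | yes _ = transpose i j (f v)
      ... | no  _ = f v

      exchanged-< : ∀ {s v} → key v < s → exchanged s v ≡ transpose i j (f v)
      exchanged-< {s} {v} lt with key v <? s
      ... | yes _ = refl
      ... | no ≮  = contradiction lt ≮

      exchanged-≥ : ∀ {s v} → s ≤ key v → exchanged s v ≡ f v
      exchanged-≥ {s} {v} ge with key v <? s
      ... | yes lt = contradiction lt (≤⇒≯ ge)
      ... | no _   = refl

      rest : ℕ → Subset n
      rest s = U ─ boundary key s

      -- On either side of the cut the colors change by an injection or not at all. An edge across
      -- the cut has its inner end on the boundary, which is deleted.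
      exchanged-proper : ∀ s → Proper (rest s) (exchanged s)
      exchanged-proper s {u} {v} u∈ v∈ e eq with key u <? s | key v <? s
      ... | yes _ | yes _ =
        proper (p─q⊆p U _ u∈) (p─q⊆p U _ v∈) e (transpose-injective i j eq)
      ... | no _  | no _  = proper (p─q⊆p U _ u∈) (p─q⊆p U _ v∈) e eq
      ... | yes u<s | no v≮s = x∈p─q⇒x∉q U _ u∈
        (∈-filter⁺ (OnBoundary? key s) (u<s , v , e , ≮⇒≥ v≮s))
      ... | no u≮s | yes v<s = x∈p─q⇒x∉q U _ v∈
        (∈-filter⁺ (OnBoundary? key s) (v<s , u , E-sym G e , ≮⇒≥ u≮s))

      size : ℕ → ℕ
      size s = ∣ colorClass (rest s) (exchanged s) i ∣

      size-initial : ∣ colorClass U f i ∣ ≤ size 0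
      size-initial = p⊆q⇒∣p∣≤∣q∣ λ v∈ → let v∈U , eq = ∈-class⁻ U f v∈ in
        ∈-class⁺ (rest 0) (exchanged 0)
          (x∈p∧x∉q⇒x∈p─q v∈U λ v∈B → contradiction (proj₁ (∈-filter⁻ (OnBoundary? key 0) v∈B)) λ ())
          (trans (exchanged-≥ z≤n) eq)

      size-final : size M ≤ ∣ colorClass U f j ∣
      size-final = p⊆q⇒∣p∣≤∣q∣ λ {v} v∈ → let v∈R , eq = ∈-class⁻ (rest M) (exchanged M) v∈ in
        ∈-class⁺ U f (p─q⊆p U _ v∈R)
          (transpose≡left i j (trans (sym (exchanged-< (key<M v))) eq))

      -- Only the vertex with key `s` crosses the cut. Any other vertex keeps its color, and if it
      -- is on the boundary at `suc s`, then its key is below `s` and the same neighbor puts it on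
      -- the boundary at `s` already.
      persists : ∀ s {v} → key v ≢ s → v ∈ colorClass (rest s) (exchanged s) i →
                 v ∈ colorClass (rest (suc s)) (exchanged (suc s)) i
      persists s {v} v≢s v∈ = let v∈R , eq = ∈-class⁻ (rest s) (exchanged s) v∈ in
        ∈-class⁺ (rest (suc s)) (exchanged (suc s))
          (x∈p∧x∉q⇒x∈p─q (p─q⊆p U _ v∈R) λ v∈B →
            let v<1+s , w , e , s<w = ∈-filter⁻ (OnBoundary? key (suc s)) v∈B in
            x∈p─q⇒x∉q U _ v∈R (∈-filter⁺ (OnBoundary? key s)
              (≤∧≢⇒< (≤-pred v<1+s) v≢s , w , e , <⇒≤ s<w)))
          (trans same eq)
        where
        same : exchanged (suc s) v ≡ exchanged s v
        same with <-cmp (key v) s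
        ... | tri< lt _ _ = trans (exchanged-< (m≤n⇒m≤1+n lt)) (sym (exchanged-< lt))
        ... | tri≈ _ eq _ = contradiction eq v≢s
        ... | tri> _ _ gt = trans (exchanged-≥ gt) (sym (exchanged-≥ (<⇒≤ gt)))

      -- Since `key` is injective, at most one vertex can leave the class. Several may enter at
      -- once, when boundary vertices lose their last outer neighbor, so only the descent is
      -- bounded.
      size-step : ∀ s → size s ≤ suc (size (suc s))
      size-step s with any? (λ v → key v ℕ.≟ s)
      ... | no none = m≤n⇒m≤1+n (p⊆q⇒∣p∣≤∣q∣ λ {v} → persists s (λ eq → none (v , eq)))
      ... | yes (v , v≡s) = subst (λ x → size s ≤ x + size (suc s)) (∣⁅x⁆∣≡1 v)
        (p─q⊆r⇒∣p∣≤∣q∣+∣r∣ _ ⁅ v ⁆ _ λ {x} x∈ x∉ →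
          persists s (λ x≡s → x∉⁅y⁆⇒x≢y x∉ (key-injective (trans x≡s (sym v≡s)))) x∈)

      exchange : ∀ {t} → t ≤ ∣ colorClass U f i ∣ → ∣ colorClass U f j ∣ ≤ t → ColorOfSize K t U
      exchange t≤i j≤t =
        let s , eq = discrete-ivt size size-step (≤-trans t≤i size-initial) M (≤-trans size-final j≤t)
        in i , rest s , exchanged s , p─q⊆p U _ , exchanged-proper s , eq ,
           ≤-trans (∣p∣≤∣q∣+∣p─q∣ U (boundary key s)) (+-monoˡ-≤ _ (∣boundary∣≤p s))

    -- Serves the case where every class exceeds `t`, so that no `j` is available for an exchange.
    -- The surplus of class `i`, at most `p` vertices, is deleted.
    shrink : ∀ {K t} (U : Subset n) (f : Fin n → Fin K) → Proper U f → ∀ i →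
             t ≤ ∣ colorClass U f i ∣ → ∣ colorClass U f i ∣ ≤ t + p → ColorOfSize K t U
    shrink {K} {t} U f proper i t≤ ≤t+p
      with subset-of-size (colorClass U f i) (∣ colorClass U f i ∣ ∸ t) (m∸n≤m _ t)
    ... | Y , Y⊆ , ∣Y∣ = i , U ─ Y , f , p─q⊆p U Y , Proper-⊆ (p─q⊆p U Y) proper , size-eq ,
      ≤-trans (∣p∣≤∣q∣+∣p─q∣ U Y) (+-monoˡ-≤ _ (≤-trans (≤-reflexive ∣Y∣) (m≤n+o⇒m∸n≤o _ t ≤t+p)))
      where
      C = colorClass U f i
      C─Y≡ : colorClass (U ─ Y) f i ≡ C ─ Y
      C─Y≡ = ⊆-antisym
        (λ v∈ → let v∈U─Y , eq = ∈-class⁻ (U ─ Y) f v∈ in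
          x∈p∧x∉q⇒x∈p─q (∈-class⁺ U f (p─q⊆p U Y v∈U─Y) eq) (x∈p─q⇒x∉q U Y v∈U─Y))
        (λ v∈ → let v∈U , eq = ∈-class⁻ U f (p─q⊆p C Y v∈) in
          ∈-class⁺ (U ─ Y) f (x∈p∧x∉q⇒x∈p─q v∈U (x∈p─q⇒x∉q C Y v∈)) eq)
      size-eq : ∣ colorClass (U ─ Y) f i ∣ ≡ t
      size-eq = +-cancelˡ-≡ ∣ Y ∣ _ _ (begin
        ∣ Y ∣ + ∣ colorClass (U ─ Y) f i ∣  ≡⟨ cong (λ q → ∣ Y ∣ + ∣ q ∣) C─Y≡ ⟩
        ∣ Y ∣ + ∣ C ─ Y ∣                   ≡⟨ q⊆p⇒∣p∣≡∣q∣+∣p─q∣ C Y Y⊆ ⟨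
        ∣ C ∣                               ≡⟨ m∸n+n≡m t≤ ⟨
        (∣ C ∣ ∸ t) + t                     ≡⟨ cong (_+ t) ∣Y∣ ⟨
        ∣ Y ∣ + t                           ∎)
        where open ≡-Reasoning

    -- Averaging: `lower` yields a class with at least `t` vertices, `upper` one with at most
    -- `t + p`. If some class has at most `t`, an exchange applies; otherwise the class with at most
    -- `t + p` vertices is shrunk.
    color-of-size : ∀ {K t} (U : Subset n) (f : Fin n → Fin (suc K)) → Proper U f →
                    suc K * t ≤ ∣ U ∣ → ∣ U ∣ < suc K * suc (t + p) → ColorOfSize (suc K) t U
    color-of-size {K} {t} U f proper lower upper
      with any? (λ c → t ≤? ∣ colorClass U f c ∣) | any? (λ c → ∣ colorClass U f c ∣ ≤? t)
         | any? (λ c → ∣ colorClass U f c ∣ ≤? t + p)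
    ... | no none | _ | _ = contradiction
      (≤-trans (cover-bound U (colorClass U f) (λ {v} v∈ → f v , ∈-class⁺ U f v∈ refl)
                 (λ c → ≰⇒> (λ le → none (c , le)))) lower)
      (m+1+n≰m ∣ U ∣)
    ... | yes (i , t≤i) | yes (j , j≤t) | _ = Exchange.exchange U f proper i j t≤i j≤t
    ... | yes _ | no none | yes (i , le) =
      shrink U f proper i (<⇒≤ (≰⇒> (λ le′ → none (i , le′)))) le
    ... | yes _ | no _ | no none = contradiction
      (packing-bound U (colorClass U f) (λ c v∈ → proj₁ (∈-class⁻ U f v∈))
        (λ x y → trans (sym (proj₂ (∈-class⁻ U f x))) (proj₂ (∈-class⁻ U f y)))
        (λ c → ≰⇒> (λ le → none (c , le))))
      (<⇒≱ upper)

    -- Balancing all classes by induction on the number of colors.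

    -- The value `m` is fixed in advance, so that classes completed at different stages of the
    -- induction have compatible sizes.
    record Balanced {K : ℕ} (m q : ℕ) (U : Subset n) : Set where
      constructor balanced
      field
        kept   : Subset n
        color  : Fin n → Fin K
        kept⊆U : kept ⊆ U
        proper : Proper kept color
        lower  : ∀ c → m ≤ ∣ colorClass kept color c ∣
        upper  : ∀ c → ∣ colorClass kept color c ∣ ≤ suc m
        loss   : ∣ U ∣ ≤ q + ∣ kept ∣

    -- Puts the finished class `C` back on top of a balanced coloring with one color fewer.
    -- `punchIn i` renames the other colors so as to avoid `i`, and `R` is disjoint from `C`, so
    -- neither side alters the class sizes of the other.
    module Extend {k : ℕ} {m q t : ℕ} (U : Subset n) (f : Fin n → Fin (suc (suc k)))
      (proper : Proper U f) (i : Fin (suc (suc k)))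
      (t≡ : ∣ colorClass U f i ∣ ≡ t) (m≤t : m ≤ t) (t≤1+m : t ≤ suc m)
      (R : Subset n) (R⊆ : R ⊆ U ─ colorClass U f i)
      (B : Balanced {suc k} m q R)
      where

      open Balanced B renaming (kept to W; color to g; proper to g-proper; kept⊆U to W⊆R)

      C = colorClass U f i

      kept′ : Subset n
      kept′ = C ∪ W

      color′ : Fin n → Fin (suc (suc k))
      color′ v with v ∈? C
      ... | yes _ = i
      ... | no  _ = punchIn i (g v)

      W∌C : ∀ {v} → v ∈ W → v ∉ C
      W∌C v∈W = x∈p─q⇒x∉q U C (R⊆ (W⊆R v∈W))

      color′-C : ∀ {v} → v ∈ C → color′ v ≡ i
      color′-C {v} v∈C with v ∈? C
      ... | yes _ = refl
      ... | no v∉C = contradiction v∈C v∉C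

      color′-W : ∀ {v} → v ∈ W → color′ v ≡ punchIn i (g v)
      color′-W {v} v∈W with v ∈? C
      ... | yes v∈C = contradiction v∈C (W∌C v∈W)
      ... | no _ = refl

      kept′⊆U : kept′ ⊆ U
      kept′⊆U v∈ with x∈p∪q⁻ C W v∈
      ... | inj₁ v∈C = proj₁ (∈-class⁻ U f v∈C)
      ... | inj₂ v∈W = p─q⊆p U C (R⊆ (W⊆R v∈W))

      proper′ : Proper kept′ color′
      proper′ {u} {v} u∈ v∈ e eq with x∈p∪q⁻ C W u∈ | x∈p∪q⁻ C W v∈
      ... | inj₁ u∈C | inj₁ v∈C =
        let u∈U , fu = ∈-class⁻ U f u∈C ; v∈U , fv = ∈-class⁻ U f v∈C in
        proper u∈U v∈U e (trans fu (sym fv))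
      ... | inj₁ u∈C | inj₂ v∈W =
        punchInᵢ≢i i (g v) (trans (sym (color′-W v∈W)) (trans (sym eq) (color′-C u∈C)))
      ... | inj₂ u∈W | inj₁ v∈C =
        punchInᵢ≢i i (g u) (trans (sym (color′-W u∈W)) (trans eq (color′-C v∈C)))
      ... | inj₂ u∈W | inj₂ v∈W = g-proper u∈W v∈W e
        (punchIn-injective i _ _ (trans (sym (color′-W u∈W)) (trans eq (color′-W v∈W))))

      class-i : colorClass kept′ color′ i ≡ C
      class-i = ⊆-antisym
        (λ v∈ → let v∈K , eq = ∈-class⁻ kept′ color′ v∈ in to v∈K eq)
        (λ v∈C → ∈-class⁺ kept′ color′ (x∈p∪q⁺ (inj₁ v∈C)) (color′-C v∈C))
        where
        to : ∀ {v} → v ∈ kept′ → color′ v ≡ i → v ∈ C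
        to {v} v∈K eq with x∈p∪q⁻ C W v∈K
        ... | inj₁ v∈C = v∈C
        ... | inj₂ v∈W = contradiction (trans (sym (color′-W v∈W)) eq) (punchInᵢ≢i i (g v))

      class-punchIn : ∀ c → colorClass kept′ color′ (punchIn i c) ≡ colorClass W g c
      class-punchIn c = ⊆-antisym
        (λ v∈ → let v∈K , eq = ∈-class⁻ kept′ color′ v∈ in to v∈K eq)
        (λ v∈ → let v∈W , eq = ∈-class⁻ W g v∈ in
          ∈-class⁺ kept′ color′ (x∈p∪q⁺ (inj₂ v∈W)) (trans (color′-W v∈W) (cong (punchIn i) eq)))
        where
        to : ∀ {v} → v ∈ kept′ → color′ v ≡ punchIn i c → v ∈ colorClass W g c
        to v∈K eq with x∈p∪q⁻ C W v∈K
        ... | inj₁ v∈C = contradiction (trans (sym eq) (color′-C v∈C)) (punchInᵢ≢i i c)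
        ... | inj₂ v∈W =
          ∈-class⁺ W g v∈W (punchIn-injective i _ _ (trans (sym (color′-W v∈W)) eq))

      sizes′ : ∀ c → m ≤ ∣ colorClass kept′ color′ c ∣ × ∣ colorClass kept′ color′ c ∣ ≤ suc m
      sizes′ c with c ≟ i
      ... | yes refl = subst (λ x → m ≤ x × x ≤ suc m) (sym (trans (cong ∣_∣ class-i) t≡)) (m≤t , t≤1+m)
      -- Every color other than `i` is the image under `punchIn i` of its collapse.
      ... | no c≢i = subst (λ d → m ≤ ∣ colorClass kept′ color′ d ∣ × ∣ colorClass kept′ color′ d ∣ ≤ suc m)
        (punchIn-collapse i c≢i)
        (subst (λ S → m ≤ ∣ S ∣ × ∣ S ∣ ≤ suc m) (sym (class-punchIn (collapse i c)))
          (lower (collapse i c) , upper (collapse i c)))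

      ∣kept′∣ : ∣ kept′ ∣ ≡ t + ∣ W ∣
      ∣kept′∣ = trans (q⊆p⇒∣p∣≡∣q∣+∣p─q∣ kept′ C (p⊆p∪q W)) (cong₂ _+_ t≡ (cong ∣_∣ (⊆-antisym
        to (λ v∈W → x∈p∧x∉q⇒x∈p─q (x∈p∪q⁺ (inj₂ v∈W)) (W∌C v∈W)))))
        where
        to : kept′ ─ C ⊆ W
        to v∈ with x∈p∪q⁻ C W (p─q⊆p kept′ C v∈)
        ... | inj₁ v∈C = contradiction v∈C (x∈p─q⇒x∉q kept′ C v∈)
        ... | inj₂ v∈W = v∈W

    colorClass-zero : ∀ U (f : Fin n → Fin 1) c → colorClass U f c ≡ U
    colorClass-zero U f zero = ⊆-antisym (λ v∈ → proj₁ (∈-class⁻ U f v∈)) (λ v∈ → ∈-class⁺ U f v∈ (only _))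
      where
      only : (c : Fin 1) → c ≡ zero
      only zero = refl

    -- The budget `p * k` pays `p` for each color but the last; the other vertices are to form `r`
    -- classes of size `suc m` and the rest of size `m`. The bound on `r` is not strict: completing
    -- a class of size `m` keeps `r` while the number of colors drops, until they may agree.
    balance : ∀ k {m r} (U : Subset n) (f : Fin n → Fin (suc k)) → Proper U f → r ≤ suc k →
              ∣ U ∣ ≡ r + suc k * m + p * k → Balanced {suc k} m (p * k) U

    balance-step : ∀ k {m r t} (U : Subset n) (f : Fin n → Fin (suc (suc k))) → Proper U f →
                   r ≤ suc k → m ≤ t → t ≤ suc m → suc (suc k) * t ≤ ∣ U ∣ →
                   ∣ U ∣ ≡ p + (t + (r + suc k * m + p * k)) → Balanced {suc (suc k)} m (p * suc k) U

    balance zero {m} {r} U f proper r≤1 ∣U∣ = balanced U f ⊆-refl proper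
      (λ c → subst (λ S → m ≤ ∣ S ∣) (sym (colorClass-zero U f c))
        (≤-trans (m≤n+m m r) (≤-reflexive (sym eq))))
      (λ c → subst (λ S → ∣ S ∣ ≤ suc m) (sym (colorClass-zero U f c))
        (≤-trans (≤-reflexive eq) (+-monoˡ-≤ m r≤1)))
      (m≤n+m _ _)
      where
      lem : ∀ r m p → r + 1 * m + p * 0 ≡ r + m
      lem = solve-∀
      eq : ∣ U ∣ ≡ r + m
      eq = trans ∣U∣ (lem r m p)
    -- While `r` is below the number of colors, the next class gets size `m`; once they are equal,
    -- all remaining classes get size `suc m`.
    balance (suc k) {m} {r} U f proper r≤ ∣U∣ with r ≤? suc k
    ... | yes r≤′ = balance-step k U f proper r≤′ ≤-refl (n≤1+n m)
        (≤-trans (≤-trans (m≤n+m _ r) (m≤m+n _ _)) (≤-reflexive (sym ∣U∣)))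
        (trans ∣U∣ (lem r k m p))
      where
      lem : ∀ r k m p → r + suc (suc k) * m + p * suc k ≡ p + (m + (r + suc k * m + p * k))
      lem = solve-∀
    ... | no r≰ with ≤-antisym r≤ (≰⇒> r≰)
    ... | refl = balance-step k {m} {suc k} U f proper ≤-refl (n≤1+n m) ≤-refl
        (≤-trans (≤-reflexive (*-suc (suc (suc k)) m)) (≤-trans (m≤m+n _ _) (≤-reflexive (sym ∣U∣))))
        (trans ∣U∣ (lem k m p))
      where
      lem : ∀ k m p → suc (suc k) + suc (suc k) * m + p * suc k ≡
                      p + (suc m + (suc k + suc k * m + p * k))
      lem = solve-∀

    balance-step k {m} {r} {t} U f proper r≤ m≤t t≤1+m lower ∣U∣
      with color-of-size U f proper lower upper
      where
      lem : ∀ k t p → suc (p + (t + (suc k + suc k * t + p * k))) + p ≡ suc (suc k) * suc (t + p)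
      lem = solve-∀
      open ≤-Reasoning
      upper : ∣ U ∣ < suc (suc k) * suc (t + p)
      -- Replacing `r` by `suc k` and `m` by `t` gives a count that is still `p + 1` below the
      -- product.
      upper = begin
        suc ∣ U ∣ ≡⟨ cong suc ∣U∣ ⟩
        suc (p + (t + (r + suc k * m + p * k)))
          ≤⟨ s≤s (+-monoʳ-≤ p (+-monoʳ-≤ t (+-monoˡ-≤ (p * k) (+-mono-≤ r≤ (*-monoʳ-≤ (suc k) m≤t))))) ⟩
        suc (p + (t + (suc k + suc k * t + p * k))) ≤⟨ m≤m+n _ p ⟩
        suc (p + (t + (suc k + suc k * t + p * k))) + p ≡⟨ lem k t p ⟩
        suc (suc k) * suc (t + p) ∎
    ... | i , W , g , W⊆U , g-proper , t≡ , loss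
      -- The vertices outside the finished class are cut down to exactly the number the induction
      -- hypothesis asks for. The loss of at most `p` guarantees that there are enough of them.
      with subset-of-size (W ─ colorClass W g i) (r + suc k * m + p * k)
             (+-cancelˡ-≤ t _ _ (+-cancelˡ-≤ p _ _ (begin
               p + (t + (r + suc k * m + p * k))  ≡⟨ ∣U∣ ⟨
               ∣ U ∣                              ≤⟨ loss ⟩
               p + ∣ W ∣
                 ≡⟨ cong (p +_) (q⊆p⇒∣p∣≡∣q∣+∣p─q∣ W _ (λ v∈ → proj₁ (∈-class⁻ W g v∈))) ⟩
               p + (∣ colorClass W g i ∣ + ∣ W ─ colorClass W g i ∣)
                 ≡⟨ cong (λ x → p + (x + ∣ W ─ colorClass W g i ∣)) t≡ ⟩
               p + (t + ∣ W ─ colorClass W g i ∣) ∎)))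
      where open ≤-Reasoning
    ... | R , R⊆ , ∣R∣ = balanced X.kept′ X.color′ (⊆-trans X.kept′⊆U W⊆U) X.proper′
        (λ c → proj₁ (X.sizes′ c)) (λ c → proj₂ (X.sizes′ c)) (begin
        ∣ U ∣                                    ≡⟨ ∣U∣ ⟩
        p + (t + (r + suc k * m + p * k))        ≡⟨ cong (λ x → p + (t + x)) ∣R∣ ⟨
        p + (t + ∣ R ∣)                          ≤⟨ +-monoʳ-≤ p (+-monoʳ-≤ t (Balanced.loss B)) ⟩
        p + (t + (p * k + ∣ Balanced.kept B ∣))  ≡⟨ lem p t k _ ⟩
        p * suc k + (t + ∣ Balanced.kept B ∣)    ≡⟨ cong (p * suc k +_) X.∣kept′∣ ⟨
        p * suc k + ∣ X.kept′ ∣                  ∎)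
      where
      open ≤-Reasoning
      lem : ∀ p t k w → p + (t + (p * k + w)) ≡ p * suc k + (t + w)
      lem = solve-∀
      C = colorClass W g i
      -- No vertex of `R` has color `i`, so `collapse i` never takes its junk value here and merges
      -- no two colors.
      f′-proper : Proper R (collapse i ∘ g)
      f′-proper u∈ v∈ e eq = g-proper (p─q⊆p W C (R⊆ u∈)) (p─q⊆p W C (R⊆ v∈)) e
        (trans (sym (punchIn-collapse i (≢i u∈))) (trans (cong (punchIn i) eq) (punchIn-collapse i (≢i v∈))))
        where
        ≢i : ∀ {v} → v ∈ R → g v ≢ i
        ≢i v∈ eq = x∈p─q⇒x∉q W C (R⊆ v∈) (∈-class⁺ W g (p─q⊆p W C (R⊆ v∈)) eq)
      B = balance k {m} {r} R (collapse i ∘ g) f′-proper r≤ ∣R∣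
      module X = Extend W g g-proper i t≡ m≤t t≤1+m R R⊆ B

    balance-any : ∀ k (U : Subset n) (f : Fin n → Fin (suc k)) → Proper U f →
                  ∃[ m ] Balanced {suc k} m (p * k) U
    balance-any k U f proper with p * k ≤? ∣ U ∣
    -- Once the budget is set aside, division with remainder gives the smaller class size `m` and
    -- the number `r` of larger classes.
    ... | yes pk≤ = d / suc k , balance k {d / suc k} {d % suc k} U f proper (<⇒≤ (m%n<n d (suc k)))
      (begin
        ∣ U ∣                                      ≡⟨ m∸n+n≡m pk≤ ⟨
        d + p * k                                  ≡⟨ cong (_+ p * k) (m≡m%n+[m/n]*n d (suc k)) ⟩
        d % suc k + d / suc k * suc k + p * k
          ≡⟨ cong (λ x → d % suc k + x + p * k) (*-comm (d / suc k) (suc k)) ⟩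
        d % suc k + suc k * (d / suc k) + p * k    ∎)
      where
      open ≡-Reasoning
      d = ∣ U ∣ ∸ p * k
    -- The budget exceeds `∣ U ∣`, so everything is deleted and all classes are empty.
    ... | no pk≰ = 0 , balanced ⊥ f ⊥⊆ (λ u∈ → contradiction u∈ ∉⊥) (λ _ → z≤n)
      (λ c → ≤-trans (p⊆q⇒∣p∣≤∣q∣ (λ v∈ → proj₁ (∈-class⁻ ⊥ f v∈)))
               (≤-trans (≤-reflexive (∣⊥∣≡0 n)) z≤n))
      (≤-trans (<⇒≤ (≰⇒> pk≰)) (m≤m+n _ _))

-- Path decompositions

-- The value is L if P holds nowhere.
least : ∀ {L} {P : Pred (Fin L) 0ℓ} → Decidable P → Fin (suc L)
least {zero}  P? = zero
least {suc L} P? with P? zero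
... | yes _ = zero
... | no  _ = suc (least (P? ∘ suc))

least-≤ : ∀ {L} {P : Pred (Fin L) 0ℓ} (P? : Decidable P) {i} → P i → toℕ (least P?) ≤ toℕ i
least-≤ {suc L} P? {i} Pi with P? zero | i
... | yes _  | _     = z≤n
... | no ¬P₀ | zero  = contradiction Pi ¬P₀
... | no _   | suc j = s≤s (least-≤ (P? ∘ suc) Pi)

least-attained : ∀ {L} {P : Pred (Fin L) 0ℓ} (P? : Decidable P) {i} → P i →
                 ∃[ j ] P j × toℕ j ≡ toℕ (least P?)
least-attained {suc L} P? {i} Pi with P? zero | i
... | yes P₀ | _     = zero , P₀ , refl
... | no ¬P₀ | zero  = contradiction Pi ¬P₀
... | no _   | suc j = let j′ , Pj , eq = least-attained (P? ∘ suc) Pi in suc j′ , Pj , cong suc eq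

∣bag∣≤max : ∀ {L} (bag : Fin L → Subset n) i → ∣ bag i ∣ ≤ foldr (λ B m → ∣ B ∣ ⊔ m) 0 bag
∣bag∣≤max bag zero    = m≤m⊔n _ _
∣bag∣≤max bag (suc i) = ≤-trans (∣bag∣≤max (bag ∘ suc) i) (m≤n⊔m _ _)

module Layout {G : Graph n} (D : PathDecomposition G) {p : ℕ} (width≤p : width D ≤ p) where

  M : ℕ
  M = suc (length D) * n

  first : Fin n → Fin (suc (length D))
  first v = least (λ i → v ∈? bag D i)

  -- Lexicographic order on pairs: by first bag, then by the vertex itself to break ties. Elements
  -- outside the graph lie in no bag and so come last.
  key : Fin n → ℕ
  key v = toℕ (combine (first v) v)

  key-injective : ∀ {u v} → key u ≡ key v → u ≡ v
  key-injective {u} {v} eq = combine-injectiveʳ (first u) u (first v) v (toℕ-injective eq)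

  key<M : ∀ v → key v < M
  key<M v = toℕ<n (combine (first v) v)

  first-mono : ∀ {u v} → key u ≤ key v → toℕ (first u) ≤ toℕ (first v)
  first-mono {u} {v} le = ≮⇒≥ λ lt → <⇒≱ (combine-monoˡ-< v u lt) le

  -- Any edge leaving the prefix that ends before v has both ends in a bag
  -- from first v on, so its inner end lies in the bag first v.
  boundary⊆bag : ∀ {v j} → toℕ j ≡ toℕ (first v) → boundary G key (key v) ⊆ bag D j
  boundary⊆bag {v} {j} j≡ {u} u∈ =
    let u<v , w , e , v≤w = ∈-filter⁻ (OnBoundary? G key (key v)) u∈
        l , u∈l , w∈l = edge-cover D e
        i , u∈i , i≡ = least-attained (λ i → u ∈? bag D i) u∈l
    in contiguous D
         (≤-trans (≤-reflexive i≡) (≤-trans (first-mono (<⇒≤ u<v)) (≤-reflexive (sym j≡))))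
         (≤-trans (≤-reflexive j≡) (≤-trans (first-mono v≤w) (least-≤ (λ i → w ∈? bag D i) w∈l)))
         u∈i u∈l

  -- The bag contains the boundary and also `v`, which is not in its own prefix. This strict
  -- inclusion accounts for the minus one in the width.
  boundary-at-vertex : ∀ {v} → v ∈ V G → ∣ boundary G key (key v) ∣ ≤ p
  boundary-at-vertex {v} v∈V with least-attained (λ i → v ∈? bag D i) (proj₂ (vertex-cover D v∈V))
  ... | j , v∈j , j≡ = ≤-pred (begin-strict
    ∣ boundary G key (key v) ∣  <⟨ p⊂q⇒∣p∣<∣q∣ (boundary⊆bag j≡ , v , v∈j ,
      λ v∈ → <-irrefl refl (proj₁ (∈-filter⁻ (OnBoundary? G key (key v)) v∈))) ⟩
    ∣ bag D j ∣                 ≤⟨ ∣bag∣≤max (bag D) j ⟩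
    foldr (λ B m → ∣ B ∣ ⊔ m) 0 (bag D)  ≤⟨ m≤n+m∸n _ 1 ⟩
    suc (width D)               ≤⟨ s≤s width≤p ⟩
    suc p                       ∎)
    where open ≤-Reasoning

  boundary-beyond-M : ∀ {s} → M ≤ s → ∣ boundary G key s ∣ ≤ p
  boundary-beyond-M {s} M≤s = ≤-trans (p⊆q⇒∣p∣≤∣q∣ {q = ⊥} λ u∈ →
    let _ , w , _ , s≤w = ∈-filter⁻ (OnBoundary? G key s) u∈ in
    contradiction (≤-trans M≤s s≤w) (<⇒≱ (key<M w)))
    (≤-trans (≤-reflexive (∣⊥∣≡0 n)) z≤n)

  -- Induction on the distance `d` to `M`. If no vertex of the graph has key `s`, every outer
  -- neighbor lies beyond `s`, so the boundary at `s` is contained in that at `suc s`; this moves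
  -- the cut up to the key of a vertex or to `M`.
  ∣boundary∣≤p′ : ∀ d s → s + d ≡ M → ∣ boundary G key s ∣ ≤ p
  ∣boundary∣≤p′ zero s eq = boundary-beyond-M (≤-reflexive (trans (sym eq) (+-identityʳ s)))
  ∣boundary∣≤p′ (suc d) s eq with any? (λ v → (v ∈? V G) ×-dec (key v ℕ.≟ s))
  ... | yes (v , v∈V , refl) = boundary-at-vertex v∈V
  ... | no none = ≤-trans (p⊆q⇒∣p∣≤∣q∣ λ u∈ →
      let u<s , w , e , s≤w = ∈-filter⁻ (OnBoundary? G key s) u∈ in
      ∈-filter⁺ (OnBoundary? G key (suc s)) (m≤n⇒m≤1+n u<s , w , e ,
        ≤∧≢⇒< s≤w λ eq′ → none (w , E⇒V G (E-sym G e) , sym eq′)))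
    (∣boundary∣≤p′ d (suc s) (trans (sym (+-suc s d)) eq))

  ∣boundary∣≤p : ∀ s → ∣ boundary G key s ∣ ≤ p
  ∣boundary∣≤p s with s ≤? M
  ... | yes s≤M = ∣boundary∣≤p′ (M ∸ s) s (m+[n∸m]≡n s≤M)
  ... | no s≰M = boundary-beyond-M (<⇒≤ (≰⇒> s≰M))

-- From balanced to equitable colorings.

dist≤1 : ∀ {m a b} → m ≤ a → a ≤ suc m → m ≤ b → b ≤ suc m → dist a b ≤ 1
dist≤1 {m} {a} {b} m≤a a≤ m≤b b≤ with ≤-total a b
... | inj₁ a≤b = ≤-trans (≤-reflexive (m≤n⇒∣m-n∣≡n∸m a≤b))
  (m≤n+o⇒m∸n≤o b a (≤-trans b≤ (≤-trans (s≤s m≤a) (≤-reflexive (+-comm 1 a)))))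
... | inj₂ b≤a = ≤-trans (≤-reflexive (m≤n⇒∣n-m∣≡n∸m b≤a))
  (m≤n+o⇒m∸n≤o a b (≤-trans a≤ (≤-trans (s≤s m≤b) (≤-reflexive (+-comm 1 b)))))

theorem4 : ∀ {n : ℕ} (G : Graph n) (k p : ℕ) → 1 ≤ k →
    Colorable k G → PathwidthAtMost p G →
    AlmostEquitablyColorable (p * (k ∸ 1)) k G
theorem4 {n} G (suc k) p _ col (D , width≤p) =
  V G ─ W , p─q⊆p (V G) W ,
  +-cancelˡ-≤ ∣ W ∣ _ _ (begin
    ∣ W ∣ + ∣ V G ─ W ∣  ≡⟨ q⊆p⇒∣p∣≡∣q∣+∣p─q∣ (V G) W kept⊆U ⟨
    ∣ V G ∣              ≤⟨ loss ⟩
    p * k + ∣ W ∣        ≡⟨ +-comm (p * k) ∣ W ∣ ⟩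
    ∣ W ∣ + p * k        ∎) ,
  equitable , λ c d → dist≤1 (lower c) (upper c) (lower d) (upper d)
  where
  open ≤-Reasoning
  open Layout D width≤p
  open Balancing G key key-injective M key<M p ∣boundary∣≤p

  color₀ : Fin n → Fin (suc k)
  color₀ v with v ∈? V G
  ... | yes v∈V = proj₁ (covers col v∈V)
  -- A default color outside the graph; properness is only claimed on `V G`.
  ... | no _    = zero

  color₀-class : ∀ {v} → v ∈ V G → v ∈ class col (color₀ v)
  color₀-class {v} v∈V with v ∈? V G
  ... | yes v∈V′ = proj₂ (covers col v∈V′)
  ... | no v∉V   = contradiction v∈V v∉V

  color₀-proper : Proper G (V G) color₀
  color₀-proper {u} {v} u∈V v∈V e eq = stable col (color₀ v)
    (subst (λ c → u ∈ class col c) eq (color₀-class u∈V)) (color₀-class v∈V) e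

  result = balance-any k (V G) color₀ color₀-proper
  open Balanced (proj₂ result) renaming (kept to W)

  equitable : Coloring (suc k) (G ∖ (V G ─ W))
  equitable = record
    { class    = colorClass W color
    ; class⊆V  = λ c v∈ → let v∈W = proj₁ (∈-class⁻ W color v∈) in
        x∈p∧x∉q⇒x∈p─q (kept⊆U v∈W) (λ v∈X → x∈p─q⇒x∉q (V G) W v∈X v∈W)
    ; covers   = λ {v} v∈ → color v , ∈-class⁺ W color (in-W v∈) refl
    ; disjoint = λ v∈c v∈d →
        trans (sym (proj₂ (∈-class⁻ W color v∈c))) (proj₂ (∈-class⁻ W color v∈d))
    ; stable   = λ c u∈ v∈ (e , _) →
        let u∈W , fu = ∈-class⁻ W color u∈ ; v∈W , fv = ∈-class⁻ W color v∈ in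
        proper u∈W v∈W e (trans fu (sym fv))
    }
    where
    in-W : ∀ {v} → v ∈ V G ─ (V G ─ W) → v ∈ W
    in-W {v} v∈ with v ∈? W
    ... | yes v∈W = v∈W
    ... | no v∉W  = contradiction (x∈p∧x∉q⇒x∈p─q (p─q⊆p (V G) _ v∈) v∉W) (x∈p─q⇒x∉q (V G) _ v∈)
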